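{- Let $r\ge1$ and let $D=\{ -r,\dots,r\}^2\subseteq\mathbb{Z}^2$ be the relative $r$-neighborhood of the king grid. Let $a,b$ be non-negative integers with $a\neq b$. Then every $(D,b,a)$-covering is two-periodic.
   Context: A $(D,b,a)$-covering is a configuration $c\in\{0,1\}^{\mathbb{Z}^2}$ such that for every $\vec u\in\mathbb{Z}^2$, the number of $\vec v\in\vec u+D$ with $c_{\vec v}=1$ equals $a$ if $c_{\vec u}=0$ and equals $b$ if $c_{\vec u}=1$. (The king grid has vertex set $\mathbb{Z}^2$, with $\vec u,\vec v$ adjacent iff $\vec u-\vec v\in\{(\pm1,0),(0,\pm1),(\pm1,\pm1)\}$.) A configuration $c$ is $\vec t$-periodic if $c_{\vec u+\vec t}=c_{\vec u}$ for all $\vec u$. It is two-periodic if it is $\vec t_1$- and $\vec t_2$-periodic for two linearly independent $\vec t_1,\vec t_2\in\mathbb{Z}^2$. -}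

module Defs where

open import Data.Nat as ℕ using (ℕ; suc)
open import Data.Integer as ℤ using (ℤ; +_; -_; _+_; _-_; _*_)
open import Data.Bool using (Bool; true; false; if_then_else_)
open import Data.Product using (_×_; _,_; Σ-syntax)
open import Data.List using (List; []; _∷_; map; concatMap; upTo)
open import Data.Nat.ListAction using (sum)
open import Relation.Binary.PropositionalEquality using (_≡_; _≢_)

Point : Set
Point = ℤ × ℤ

Config : Set
Config = Point → Bool

_⊕_ : Point → Point → Point
(x₁ , y₁) ⊕ (x₂ , y₂) = (x₁ + x₂ , y₁ + y₂)

interval : ℕ → List ℤ
interval r = map (λ i → (+ i) - (+ r)) (upTo (suc (r ℕ.+ r)))

kingNbhd : ℕ → List Point
kingNbhd r = concatMap (λ dx → map (λ dy → (dx , dy)) (interval r)) (interval r)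

bit : Bool → ℕ
bit true  = 1
bit false = 0

countOnes : List Point → Config → Point → ℕ
countOnes D c u = sum (map (λ d → bit (c (u ⊕ d))) D)

IsCovering : List Point → ℕ → ℕ → Config → Set
IsCovering D b a c = ∀ u → countOnes D c u ≡ (if c u then b else a)

IsPeriodic : Config → Point → Set
IsPeriodic c t = ∀ u → c (u ⊕ t) ≡ c u

LinIndep : Point → Point → Set
LinIndep (x₁ , y₁) (x₂ , y₂) = x₁ * y₂ - y₁ * x₂ ≢ + 0

TwoPeriodic : Config → Set
TwoPeriodic c = Σ[ t₁ ∈ Point ] Σ[ t₂ ∈ Point ]
  (LinIndep t₁ t₂ × IsPeriodic c t₁ × IsPeriodic c t₂)

{-# OPTIONS --safe #-}
module Submission where

-- Write χ for the indicator of the covering, S_m h (u) = Σ_{v ∈ D} h (u + m v), d = b − a and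
-- Δ_w h (u) = h (u + w) − h (u). For every t the bounded function h = Δ_t χ satisfies S_1 h = d h.
-- Raising this relation to the p-th power for a prime p and comparing with its p-fold dilate modulo p gives
-- S_p h = d h once p exceeds the values involved; hence S_m h = d h for all m in a progression 1 + k M.
-- Eliminating all but one corner of the square between these relations shows that a product of
-- differences Δ_w kills h. The factors are peeled off one at a time: a bounded function with
-- Δ_w h doubly periodic is periodic along w, and then the dilated relations, which become
-- one-dimensional modulo w, can be eliminated once more to give a second period. Finally
-- double periodicity of Δ_t χ for t = e₁, e₂ passes to χ.

open import Defs
open import Data.Bool using (true; false; if_then_else_)
open import Data.Integer using (ℤ; +_; -[1+_]; ∣_∣; _+_; _-_; _*_; -_; 0ℤ; 1ℤ; ≢-nonZero)
open import Data.Integer.DivMod using (_%ℕ_; _/ℕ_; a≡a%ℕn+[a/ℕn]*n)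
open import Data.Integer.Divisibility.Signed
import Data.Integer.Properties as ℤ
open import Data.Integer.Tactic.RingSolver using (solve-∀)
open import Data.List using (List; []; _∷_; _++_; map; concatMap; replicate; length; upTo; applyUpTo)
open import Data.List.Membership.Propositional using (_∈_)
open import Data.List.Properties using (length-map; map-cong; map-id; map-∘; upTo-∷ʳ)
open import Data.List.Relation.Unary.All as All using (All; []; _∷_)
import Data.List.Relation.Unary.All.Properties as All
open import Data.Nat as ℕ using (ℕ; zero; suc; _≥_; _!; z≤n; s≤s; NonZero)
import Data.Nat.Divisibility as ℕ
open import Data.Nat.ListAction using (product; sum)
open import Data.Nat.ListAction.Properties using (∈⇒∣product)
open import Data.Nat.Primality using (Prime; euclidsLemma; prime⇒nonZero; ¬prime[0]; ¬prime[1])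
open import Data.Nat.Primality.Factorisation using (PrimeFactorisation; factorise)
import Data.Nat.Properties as ℕ
import Data.Nat.Tactic.RingSolver as ℕ
open import Data.Product using (_×_; _,_; proj₁; proj₂; Σ-syntax; swap; map₂)
open import Data.Sum using (inj₁; inj₂)
open import Function using (_∘_)
open import Relation.Binary.PropositionalEquality
open import Relation.Nullary using (¬_; contradiction)

open ≡-Reasoning

Fn : Set
Fn = Point → ℤ

infixr 21 _·_
_·_ : ℤ → Point → Point
k · (x , y) = (k * x , k * y)

-- Finite sums

∑ : {A : Set} → List A → (A → ℤ) → ℤ
∑ []       f = 0ℤ
∑ (x ∷ xs) f = f x + ∑ xs f

module _ {A : Set} where

  ∑-cong : ∀ (xs : List A) {f g : A → ℤ} → (∀ x → f x ≡ g x) → ∑ xs f ≡ ∑ xs g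
  ∑-cong []       eq = refl
  ∑-cong (x ∷ xs) eq = cong₂ _+_ (eq x) (∑-cong xs eq)

  ∑-0 : ∀ (xs : List A) → ∑ xs (λ _ → 0ℤ) ≡ 0ℤ
  ∑-0 []       = refl
  ∑-0 (x ∷ xs) = trans (ℤ.+-identityˡ _) (∑-0 xs)

  ∑-+ : ∀ (xs : List A) (f g : A → ℤ) → ∑ xs f + ∑ xs g ≡ ∑ xs (λ x → f x + g x)
  ∑-+ []       f g = refl
  ∑-+ (x ∷ xs) f g = trans (lem (f x) _ (g x) _) (cong (_+_ (f x + g x)) (∑-+ xs f g))
    where
    lem : ∀ a b c d → (a + b) + (c + d) ≡ (a + c) + (b + d)
    lem = solve-∀

  ∑-- : ∀ (xs : List A) (f g : A → ℤ) → ∑ xs f - ∑ xs g ≡ ∑ xs (λ x → f x - g x)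
  ∑-- []       f g = refl
  ∑-- (x ∷ xs) f g = trans (lem (f x) _ (g x) _) (cong (_+_ (f x - g x)) (∑-- xs f g))
    where
    lem : ∀ a b c d → (a + b) - (c + d) ≡ (a - c) + (b - d)
    lem = solve-∀

  ∑-++ : ∀ (xs ys : List A) (f : A → ℤ) → ∑ (xs ++ ys) f ≡ ∑ xs f + ∑ ys f
  ∑-++ []       ys f = sym (ℤ.+-identityˡ _)
  ∑-++ (x ∷ xs) ys f = trans (cong (_+_ (f x)) (∑-++ xs ys f)) (sym (ℤ.+-assoc (f x) _ _))

  ∑-bound : ∀ (xs : List A) (f : A → ℤ) B → (∀ x → ∣ f x ∣ ℕ.≤ B) → ∣ ∑ xs f ∣ ℕ.≤ length xs ℕ.* B
  ∑-bound []       f B le = z≤n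
  ∑-bound (x ∷ xs) f B le =
    ℕ.≤-trans (ℤ.∣i+j∣≤∣i∣+∣j∣ (f x) _) (ℕ.+-mono-≤ (le x) (∑-bound xs f B le))

  ∑-∣ : ∀ {m} (xs : List A) (f : A → ℤ) → (∀ x → m ∣ f x) → m ∣ ∑ xs f
  ∑-∣ []       f m∣f = divides 0ℤ refl
  ∑-∣ (x ∷ xs) f m∣f = ∣m∣n⇒∣m+n (m∣f x) (∑-∣ xs f m∣f)

  ∑-replicate-* : ∀ n (x : A) (f : A → ℤ) → ∑ (replicate n x) f ≡ + n * f x
  ∑-replicate-* zero    x f = sym (ℤ.*-zeroˡ (f x))
  ∑-replicate-* (suc n) x f = trans (cong (_+_ (f x)) (∑-replicate-* n x f)) (sym (ℤ.suc-* (+ n) (f x)))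

module _ {A B : Set} where

  ∑-map : ∀ (g : A → B) (xs : List A) (f : B → ℤ) → ∑ (map g xs) f ≡ ∑ xs (f ∘ g)
  ∑-map g []       f = refl
  ∑-map g (x ∷ xs) f = cong (_+_ (f (g x))) (∑-map g xs f)

  ∑-concatMap : ∀ (g : A → List B) (xs : List A) (f : B → ℤ) →
    ∑ (concatMap g xs) f ≡ ∑ xs (λ x → ∑ (g x) f)
  ∑-concatMap g []       f = refl
  ∑-concatMap g (x ∷ xs) f =
    trans (∑-++ (g x) (concatMap g xs) f) (cong (_+_ (∑ (g x) f)) (∑-concatMap g xs f))

  ∑-swap : ∀ (xs : List A) (ys : List B) (f : A → B → ℤ) →
    ∑ xs (λ x → ∑ ys (f x)) ≡ ∑ ys (λ y → ∑ xs (λ x → f x y))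
  ∑-swap []       ys f = sym (∑-0 ys)
  ∑-swap (x ∷ xs) ys f =
    trans (cong (_+_ (∑ ys (f x))) (∑-swap xs ys f)) (∑-+ ys (f x) (λ y → ∑ xs (λ x → f x y)))

-- The freshman's dream for sums of translations

-- The binomial coefficient of `i + j` over `i`, indexed by both parts so that no subtraction
-- occurs.
pascal : ℕ → ℕ → ℕ
pascal zero    j       = 1
pascal (suc i) zero    = 1
pascal (suc i) (suc j) = pascal i (suc j) ℕ.+ pascal (suc i) j

pascal-! : ∀ i j → pascal i j ℕ.* (i ! ℕ.* j !) ≡ (i ℕ.+ j) !
pascal-! zero    j       = lem (j !)
  where
  lem : ∀ a → 1 ℕ.* (1 ℕ.* a) ≡ a
  lem = ℕ.solve-∀
pascal-! (suc i) zero    rewrite ℕ.+-identityʳ i = lem (suc i !)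
  where
  lem : ∀ a → 1 ℕ.* (a ℕ.* 1) ≡ a
  lem = ℕ.solve-∀
pascal-! (suc i) (suc j) = begin
  (P ℕ.+ Q) ℕ.* (suc i ! ℕ.* suc j !)
    ≡⟨ lem i j P Q (i !) (j !) ⟩
  suc i ℕ.* (P ℕ.* (i ! ℕ.* suc j !)) ℕ.+ suc j ℕ.* (Q ℕ.* (suc i ! ℕ.* j !))
    ≡⟨ cong₂ (λ s t → suc i ℕ.* s ℕ.+ suc j ℕ.* t) (pascal-! i (suc j)) (pascal-! (suc i) j) ⟩
  suc i ℕ.* (i ℕ.+ suc j) ! ℕ.+ suc j ℕ.* (suc i ℕ.+ j) !
    ≡⟨ cong (λ n → suc i ℕ.* n ! ℕ.+ suc j ℕ.* (suc i ℕ.+ j) !) (ℕ.+-suc i j) ⟩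
  suc i ℕ.* (suc i ℕ.+ j) ! ℕ.+ suc j ℕ.* (suc i ℕ.+ j) !
    ≡⟨ ℕ.*-distribʳ-+ ((suc i ℕ.+ j) !) (suc i) (suc j) ⟨
  (suc i ℕ.+ suc j) ℕ.* (suc i ℕ.+ j) !
    ≡⟨ cong (λ n → (suc i ℕ.+ suc j) ℕ.* n !) (ℕ.+-suc i j) ⟨
  (suc i ℕ.+ suc j) ! ∎
  where
  P = pascal i (suc j)
  Q = pascal (suc i) j
  lem : ∀ i j P Q a b → (P ℕ.+ Q) ℕ.* ((suc i ℕ.* a) ℕ.* (suc j ℕ.* b)) ≡
    suc i ℕ.* (P ℕ.* (a ℕ.* (suc j ℕ.* b))) ℕ.+ suc j ℕ.* (Q ℕ.* ((suc i ℕ.* a) ℕ.* b))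
  lem = ℕ.solve-∀

prime∤! : ∀ {p} → Prime p → ∀ n → n ℕ.< p → ¬ p ℕ.∣ n !
prime∤! pp zero    n<p p∣ = ¬prime[1] (subst Prime (ℕ.∣1⇒≡1 p∣) pp)
prime∤! pp (suc n) n<p p∣ with euclidsLemma (suc n) (n !) pp p∣
... | inj₁ p∣n = ℕ.>⇒∤ n<p p∣n
... | inj₂ p∣n! = prime∤! pp n (ℕ.<-trans (ℕ.n<1+n n) n<p) p∣n!

-- By `pascal-!` the coefficient times two factorials is `p !`. Both factorials are of numbers below
-- p, so p divides neither of them.
prime∣pascal : ∀ {p} → Prime p → ∀ i j → suc i ℕ.+ suc j ≡ p → p ℕ.∣ pascal (suc i) (suc j)
prime∣pascal {suc p} pp i j refl
  with euclidsLemma (pascal (suc i) (suc j)) _ pp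
         (subst (suc p ℕ.∣_) (sym (pascal-! (suc i) (suc j))) (ℕ.m∣m*n (p !)))
... | inj₁ p∣ = p∣
... | inj₂ p∣ with euclidsLemma (suc i !) (suc j !) pp p∣
... | inj₁ p∣i = contradiction p∣i (prime∤! pp (suc i) (ℕ.m<m+n (suc i) (s≤s z≤n)))
... | inj₂ p∣j = contradiction p∣j (prime∤! pp (suc j) (ℕ.m<n+m (suc j) (s≤s z≤n)))

antidiagonal : ℕ → (ℕ → ℕ → ℤ) → ℤ
antidiagonal zero    H = H 0 0
antidiagonal (suc n) H = H 0 (suc n) + antidiagonal n (λ i j → H (suc i) j)

antidiagonal-last : ∀ n H →
  antidiagonal (suc n) H ≡ antidiagonal n (λ i j → H i (suc j)) + H (suc n) 0
antidiagonal-last zero    H = refl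
antidiagonal-last (suc n) H =
  trans (cong (_+_ (H 0 (suc (suc n)))) (antidiagonal-last n (λ i j → H (suc i) j)))
        (sym (ℤ.+-assoc (H 0 (suc (suc n))) _ _))

antidiagonal-cong : ∀ n {H G} → (∀ i j → H i j ≡ G i j) → antidiagonal n H ≡ antidiagonal n G
antidiagonal-cong zero    eq = eq 0 0
antidiagonal-cong (suc n) eq = cong₂ _+_ (eq 0 (suc n)) (antidiagonal-cong n (λ i j → eq (suc i) j))

antidiagonal-+ : ∀ n H G →
  antidiagonal n H + antidiagonal n G ≡ antidiagonal n (λ i j → H i j + G i j)
antidiagonal-+ zero    H G = refl
antidiagonal-+ (suc n) H G =
  trans (lem (H 0 (suc n)) _ (G 0 (suc n)) _)
        (cong (_+_ (H 0 (suc n) + G 0 (suc n))) (antidiagonal-+ n _ _))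
  where
  lem : ∀ a b c d → (a + b) + (c + d) ≡ (a + c) + (b + d)
  lem = solve-∀

antidiagonal-∣ : ∀ {m} n H → (∀ i j → i ℕ.+ j ≡ n → m ∣ H i j) → m ∣ antidiagonal n H
antidiagonal-∣ zero    H m∣H = m∣H 0 0 refl
antidiagonal-∣ (suc n) H m∣H =
  ∣m∣n⇒∣m+n (m∣H 0 (suc n) refl) (antidiagonal-∣ n _ (λ i j eq → m∣H (suc i) j (cong suc eq)))

-- With F i j = Aⁱ Bʲ h for commuting operators A and B, this is (A + B)ⁿ h.
expand : ℕ → (ℕ → ℕ → ℤ) → ℤ
expand zero    F = F 0 0
expand (suc n) F = expand n (λ i j → F (suc i) j) + expand n (λ i j → F i (suc j))

expand-cong : ∀ n {F G} → (∀ i j → F i j ≡ G i j) → expand n F ≡ expand n G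
expand-cong zero    eq = eq 0 0
expand-cong (suc n) eq =
  cong₂ _+_ (expand-cong n (λ i j → eq (suc i) j)) (expand-cong n (λ i j → eq i (suc j)))

expand-∑ : ∀ {A : Set} n (xs : List A) (F : A → ℕ → ℕ → ℤ) →
  ∑ xs (λ x → expand n (F x)) ≡ expand n (λ i j → ∑ xs (λ x → F x i j))
expand-∑ zero    xs F = refl
expand-∑ (suc n) xs F = trans (sym (∑-+ xs _ _)) (cong₂ _+_ (expand-∑ n xs _) (expand-∑ n xs _))

-- The two halves have their unmatched extreme terms at opposite ends. Once these are peeled off,
-- the remaining sums combine index by index through Pascal's rule; peeling both ends requires `n`
-- to be at least 2.
expand-pascal : ∀ n F → expand n F ≡ antidiagonal n (λ i j → + pascal i j * F i j)
expand-pascal zero          F = sym (ℤ.*-identityˡ _)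
expand-pascal (suc zero)    F = lem (F 1 0) (F 0 1)
  where
  lem : ∀ a b → a + b ≡ 1ℤ * b + 1ℤ * a
  lem = solve-∀
expand-pascal (suc (suc n)) F = begin
  expand (suc n) (λ i j → F (suc i) j) + expand (suc n) (λ i j → F i (suc j))
    ≡⟨ cong₂ _+_ (expand-pascal (suc n) (λ i j → F (suc i) j)) (expand-pascal (suc n) (λ i j → F i (suc j))) ⟩
  antidiagonal (suc n) (λ i j → + pascal i j * F (suc i) j) + (E + antidiagonal n U)
    ≡⟨ cong (_+ (E + antidiagonal n U)) (antidiagonal-last n (λ i j → + pascal i j * F (suc i) j)) ⟩
  (antidiagonal n V + + pascal (suc n) 0 * F (suc (suc n)) 0) + (E + antidiagonal n U)
    ≡⟨ lem (antidiagonal n V) _ E (antidiagonal n U) ⟩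
  E + ((antidiagonal n V + antidiagonal n U) + + 1 * F (suc (suc n)) 0)
    ≡⟨ cong (λ s → E + (s + + 1 * F (suc (suc n)) 0))
            (trans (antidiagonal-+ n V U) (antidiagonal-cong n pascal-rule)) ⟩
  E + (antidiagonal n (λ i j → + pascal (suc i) (suc j) * F (suc i) (suc j)) + + 1 * F (suc (suc n)) 0)
    ≡⟨ cong (_+_ E) (antidiagonal-last n (λ i j → + pascal (suc i) j * F (suc i) j)) ⟨
  antidiagonal (suc (suc n)) (λ i j → + pascal i j * F i j) ∎
  where
  E = + 1 * F 0 (suc (suc n))
  U V : ℕ → ℕ → ℤ
  U i j = + pascal (suc i) j * F (suc i) (suc j)
  V i j = + pascal i (suc j) * F (suc i) (suc j)
  lem : ∀ a b c d → (a + b) + (c + d) ≡ c + ((a + d) + b)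
  lem = solve-∀
  pascal-rule : ∀ i j → V i j + U i j ≡ + pascal (suc i) (suc j) * F (suc i) (suc j)
  pascal-rule i j = sym (ℤ.*-distribʳ-+ (F (suc i) (suc j)) (+ pascal i (suc j)) (+ pascal (suc i) j))

-- All inner binomial coefficients vanish modulo p, which leaves the two extreme terms.
expand-prime : ∀ {p} → Prime p → ∀ F → + p ∣ expand p F - (F 0 p + F p 0)
expand-prime {zero}        pp F = contradiction pp ¬prime[0]
expand-prime {suc zero}    pp F = contradiction pp ¬prime[1]
expand-prime {suc (suc n)} pp F =
  subst (+ suc (suc n) ∣_) (sym eq)
    (antidiagonal-∣ n mid λ i j eq →
      ∣m⇒∣m*n {m = + pascal (suc i) (suc j)} (F (suc i) (suc j)) (∣ᵤ⇒∣ (prime∣pascal pp i j (cong suc (trans (ℕ.+-suc i j) (cong suc eq))))))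
  where
  mid : ℕ → ℕ → ℤ
  mid i j = + pascal (suc i) (suc j) * F (suc i) (suc j)
  lem : ∀ a b c → (1ℤ * a + (b + 1ℤ * c)) - (a + c) ≡ b
  lem = solve-∀
  eq : expand (suc (suc n)) F - (F 0 (suc (suc n)) + F (suc (suc n)) 0) ≡ antidiagonal n mid
  eq = trans
    (cong (_- (F 0 (suc (suc n)) + F (suc (suc n)) 0))
      (trans (expand-pascal (suc (suc n)) F)
             (cong (_+_ (+ 1 * F 0 (suc (suc n))))
               (antidiagonal-last n (λ i j → + pascal (suc i) j * F (suc i) j)))))
    (lem (F 0 (suc (suc n))) (antidiagonal n mid) (F (suc (suc n)) 0))

⊕-assoc : ∀ u v w → (u ⊕ v) ⊕ w ≡ u ⊕ (v ⊕ w)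
⊕-assoc u v w = cong₂ _,_ (ℤ.+-assoc (proj₁ u) _ _) (ℤ.+-assoc (proj₂ u) _ _)

⊕-comm : ∀ u v → u ⊕ v ≡ v ⊕ u
⊕-comm u v = cong₂ _,_ (ℤ.+-comm (proj₁ u) _) (ℤ.+-comm (proj₂ u) _)

⊕-swapʳ : ∀ u v w → (u ⊕ v) ⊕ w ≡ (u ⊕ w) ⊕ v
⊕-swapʳ u v w = trans (⊕-assoc u v w) (trans (cong (u ⊕_) (⊕-comm v w)) (sym (⊕-assoc u w v)))

⊕-0· : ∀ u v → u ⊕ (+ 0) · v ≡ u
⊕-0· u v = cong₂ _,_ (lem (proj₁ u) (proj₁ v)) (lem (proj₂ u) (proj₂ v))
  where
  lem : ∀ a b → a + + 0 * b ≡ a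
  lem = solve-∀

⊕-suc· : ∀ k u v → (u ⊕ v) ⊕ (+ k) · v ≡ u ⊕ (+ suc k) · v
⊕-suc· k u v = cong₂ _,_ (lem (+ k) (proj₁ u) (proj₁ v)) (lem (+ k) (proj₂ u) (proj₂ v))
  where
  lem : ∀ k a b → (a + b) + k * b ≡ a + (1ℤ + k) * b
  lem = solve-∀

·-assoc : ∀ k l v → k · l · v ≡ (k * l) · v
·-assoc k l v = cong₂ _,_ (sym (ℤ.*-assoc k l _)) (sym (ℤ.*-assoc k l _))

·-assoc-comm : ∀ k l v → k · l · v ≡ (l * k) · v
·-assoc-comm k l v = trans (·-assoc k l v) (cong (_· v) (ℤ.*-comm k l))

·-identity : ∀ v → 1ℤ · v ≡ v
·-identity v = cong₂ _,_ (ℤ.*-identityˡ _) (ℤ.*-identityˡ _)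

act : List Point → Fn → Fn
act L h u = ∑ L (λ v → h (u ⊕ v))

act^ : List Point → ℕ → Fn → Fn
act^ L zero    h = h
act^ L (suc n) h = act L (act^ L n h)

-- Translation by `v` commutes with summation over `L`, so a power of their sum expands binomially.
act^-∷ : ∀ v L n h u → act^ (v ∷ L) n h u ≡ expand n (λ i j → act^ L j h (u ⊕ (+ i) · v))
act^-∷ v L zero    h u = cong h (sym (⊕-0· u v))
act^-∷ v L (suc n) h u = cong₂ _+_
  (trans (act^-∷ v L n h (u ⊕ v)) (expand-cong n λ i j → cong (act^ L j h) (⊕-suc· i u v)))
  (begin
    ∑ L (λ w → act^ (v ∷ L) n h (u ⊕ w))
      ≡⟨ ∑-cong L (λ w → act^-∷ v L n h (u ⊕ w)) ⟩
    ∑ L (λ w → expand n (λ i j → act^ L j h ((u ⊕ w) ⊕ (+ i) · v)))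
      ≡⟨ expand-∑ n L _ ⟩
    expand n (λ i j → ∑ L (λ w → act^ L j h ((u ⊕ w) ⊕ (+ i) · v)))
      ≡⟨ expand-cong n (λ i j → ∑-cong L λ w → cong (act^ L j h) (⊕-swapʳ u w ((+ i) · v))) ⟩
    expand n (λ i j → act^ L (suc j) h (u ⊕ (+ i) · v)) ∎)

-- Induction on the list: modulo p, splitting off `v` leaves the translate by `p · v` plus the p-th
-- power of the operator of the remaining list.
frobenius : ∀ {p} → Prime p → ∀ L h u → + p ∣ act^ L p h u - act (map ((+ p) ·_) L) h u
frobenius {zero}  pp []      h u = contradiction pp ¬prime[0]
frobenius {suc p} pp []      h u = divides 0ℤ refl
frobenius {p}     pp (v ∷ L) h u = subst (+ p ∣_) eq
  (∣m∣n⇒∣m+n (expand-prime pp F) (frobenius pp L h u))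
  where
  F : ℕ → ℕ → ℤ
  F i j = act^ L j h (u ⊕ (+ i) · v)
  A = act (map ((+ p) ·_) L) h u
  lem : ∀ e f g a → (e - (f + g)) + (f - a) ≡ e - (g + a)
  lem = solve-∀
  eq : (expand p F - (F 0 p + F p 0)) + (act^ L p h u - A) ≡ act^ (v ∷ L) p h u - (F p 0 + A)
  eq = begin
    (expand p F - (F 0 p + F p 0)) + (act^ L p h u - A)
      ≡⟨ cong (λ w → (expand p F - (F 0 p + F p 0)) + (act^ L p h w - A)) (⊕-0· u v) ⟨
    (expand p F - (F 0 p + F p 0)) + (F 0 p - A)
      ≡⟨ lem (expand p F) (F 0 p) (F p 0) A ⟩
    expand p F - (F p 0 + A)
      ≡⟨ cong (_- (F p 0 + A)) (act^-∷ v L p h u) ⟨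
    act^ (v ∷ L) p h u - (F p 0 + A) ∎

∣∧small⇒≡0 : ∀ {p} x → + p ∣ x → ∣ x ∣ ℕ.< p → x ≡ 0ℤ
∣∧small⇒≡0 {p} x p∣x x<p = ℤ.∣i∣≡0⇒i≡0 (lem ∣ x ∣ (∣⇒∣ᵤ p∣x) x<p)
  where
  lem : ∀ n → p ℕ.∣ n → n ℕ.< p → n ≡ 0
  lem zero    p∣n n<p = refl
  lem (suc n) p∣n n<p = contradiction p∣n (ℕ.>⇒∤ n<p)

-- Dilating the eigenvalue relation

record Eigen (d : ℤ) (L : List Point) (h : Fn) : Set where
  constructor eigen
  field at : ∀ u → act L h u ≡ d * h u
open Eigen

-- Some number e of copies of the origin turns L into a list acting as zero modulo p. Then so does
-- its p-th power, hence the p-fold dilate of that list; the bound lifts this from ℤ/p to ℤ.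
eigen-prime : ∀ {d L h p} B → (∀ u → ∣ h u ∣ ℕ.≤ B) → Prime p → (length L ℕ.+ ∣ d ∣) ℕ.* B ℕ.< p →
  Eigen d L h → Eigen d (map ((+ p) ·_) L) h
eigen-prime {d} {L} {h} {p} B h≤B pp N<p eig = eigen λ u →
  ℤ.i-j≡0⇒i≡j _ _ (∣∧small⇒≡0 _ (p∣diff u) (ℕ.≤-<-trans (diff-bound u) N<p))
  where
  instance _ = prime⇒nonZero pp
  O : Point
  O = 0ℤ , 0ℤ
  -- The residue of `- d` is a natural number, so it can serve as a multiplicity, and it makes
  -- `d + e` divisible by p.
  e = (- d) %ℕ p
  q = (- d) /ℕ p
  L⁺ = L ++ replicate e O
  pL = map ((+ p) ·_) L

  p∣[d+e] : + p ∣ d + + e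
  p∣[d+e] = divides (- q)
    (trans (cong (_+ + e) (trans (sym (ℤ.neg-involutive d)) (cong -_ (a≡a%ℕn+[a/ℕn]*n (- d) p)))) (lem (+ e) q (+ p)))
    where
    lem : ∀ e q p → - (e + q * p) + e ≡ (- q) * p
    lem = solve-∀

  act-L⁺ : ∀ u → act L⁺ h u ≡ (d + + e) * h u
  act-L⁺ u = begin
    act L⁺ h u
      ≡⟨ ∑-++ L (replicate e O) _ ⟩
    act L h u + ∑ (replicate e O) (λ v → h (u ⊕ v))
      ≡⟨ cong₂ _+_ (at eig u) (trans (∑-replicate-* e O _) (cong (λ w → + e * h w) (⊕-0· u O))) ⟩
    d * h u + + e * h u
      ≡⟨ ℤ.*-distribʳ-+ (h u) d (+ e) ⟨
    (d + + e) * h u ∎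

  p∣act^ : ∀ n u → + p ∣ act^ L⁺ (suc n) h u
  p∣act^ zero    u = subst (+ p ∣_) (sym (act-L⁺ u)) (∣m⇒∣m*n (h u) p∣[d+e])
  p∣act^ (suc n) u = ∑-∣ L⁺ _ (λ v → p∣act^ n (u ⊕ v))

  p∣act-pL⁺ : ∀ u → + p ∣ act (map ((+ p) ·_) L⁺) h u
  p∣act-pL⁺ u = subst (+ p ∣_) (lem (act^ L⁺ p h u) _)
    (∣m∣n⇒∣m-n (subst (λ n → + p ∣ act^ L⁺ n h u) (ℕ.suc-pred p) (p∣act^ (ℕ.pred p) u)) (frobenius pp L⁺ h u))
    where
    lem : ∀ a b → a - (a - b) ≡ b
    lem = solve-∀

  act-pL⁺ : ∀ u → act (map ((+ p) ·_) L⁺) h u ≡ act pL h u + + e * h u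
  act-pL⁺ u = begin
    act (map ((+ p) ·_) L⁺) h u
      ≡⟨ ∑-map ((+ p) ·_) L⁺ _ ⟩
    ∑ L⁺ (λ v → h (u ⊕ (+ p) · v))
      ≡⟨ ∑-++ L (replicate e O) _ ⟩
    ∑ L (λ v → h (u ⊕ (+ p) · v)) + ∑ (replicate e O) (λ v → h (u ⊕ (+ p) · v))
      ≡⟨ cong₂ _+_ (sym (∑-map ((+ p) ·_) L _))
           (trans (∑-replicate-* e O _) (cong (λ w → + e * h w) (lem u))) ⟩
    act pL h u + + e * h u ∎
    where
    lem : ∀ u → u ⊕ (+ p) · O ≡ u
    lem u = cong₂ _,_ (lem₁ (proj₁ u) (+ p)) (lem₁ (proj₂ u) (+ p))
      where
      lem₁ : ∀ a p → a + p * 0ℤ ≡ a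
      lem₁ = solve-∀

  -- Dilation fixes the copies of the origin, so their contribution `e * h u` cancels against the
  -- `e` in `d + e`.
  p∣diff : ∀ u → + p ∣ act pL h u - d * h u
  p∣diff u = subst (+ p ∣_) (trans (cong (_- (d + + e) * h u) (act-pL⁺ u)) (lem (act pL h u) d (+ e) (h u)))
    (∣m∣n⇒∣m-n (p∣act-pL⁺ u) (∣m⇒∣m*n (h u) p∣[d+e]))
    where
    lem : ∀ a d e x → (a + e * x) - (d + e) * x ≡ a - d * x
    lem = solve-∀

  diff-bound : ∀ u → ∣ act pL h u - d * h u ∣ ℕ.≤ (length L ℕ.+ ∣ d ∣) ℕ.* B
  diff-bound u = ℕ.≤-trans (ℤ.∣i-j∣≤∣i∣+∣j∣ (act pL h u) (d * h u))
    (ℕ.≤-trans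
      (ℕ.+-mono-≤
        (subst (λ n → ∣ act pL h u ∣ ℕ.≤ n ℕ.* B) (length-map ((+ p) ·_) L) (∑-bound pL _ B (λ v → h≤B (u ⊕ v))))
        (subst (ℕ._≤ ∣ d ∣ ℕ.* B) (sym (ℤ.abs-* d (h u))) (ℕ.*-monoʳ-≤ ∣ d ∣ (h≤B u))))
      (ℕ.≤-reflexive (sym (ℕ.*-distribʳ-+ B (length L) ∣ d ∣))))

-- The primes are applied one after another. Dilation preserves the length of the list, and `h` and
-- `d` stay the same, so one threshold serves for every prime.
eigen-product : ∀ {d L h} B → (∀ u → ∣ h u ∣ ℕ.≤ B) → Eigen d L h → ∀ {ps} → All Prime ps →
  All ((length L ℕ.+ ∣ d ∣) ℕ.* B ℕ.<_) ps → Eigen d (map ((+ product ps) ·_) L) h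
eigen-product {d} {L} {h} B h≤B eig [] [] =
  subst (λ L′ → Eigen d L′ h) (sym (trans (map-cong ·-identity L) (map-id L))) eig
eigen-product {d} {L} {h} B h≤B eig {p ∷ ps} (pp ∷ pps) (N<p ∷ N<ps) =
  subst (λ L′ → Eigen d L′ h) eq
    (eigen-prime B h≤B pp (subst (λ n → (n ℕ.+ ∣ d ∣) ℕ.* B ℕ.< p) (sym (length-map _ L)) N<p)
      (eigen-product B h≤B eig pps N<ps))
  where
  eq : map ((+ p) ·_) (map ((+ product ps) ·_) L) ≡ map ((+ product (p ∷ ps)) ·_) L
  eq = trans (sym (map-∘ L))
    (map-cong (λ v → trans (·-assoc (+ p) (+ product ps) v) (cong (_· v) (sym (ℤ.pos-* p (product ps))))) L)

-- Every prime factor of 1 + k N! exceeds N.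
eigen-progression : ∀ {d L h} B → (∀ u → ∣ h u ∣ ℕ.≤ B) → Eigen d L h →
  ∀ k → Eigen d (map ((+ suc (k ℕ.* ((length L ℕ.+ ∣ d ∣) ℕ.* B) !)) ·_) L) h
eigen-progression {d} {L} {h} B h≤B eig k =
  subst (λ n → Eigen d (map ((+ n) ·_) L) h) (sym isFactorisation)
    (eigen-product B h≤B eig factorsPrime (All.tabulate large))
  where
  N = (length L ℕ.+ ∣ d ∣) ℕ.* B
  open PrimeFactorisation (factorise (suc (k ℕ.* N !)))
  large : ∀ {p} → p ∈ factors → N ℕ.< p
  large {p} p∈ = ℕ.≰⇒> λ p≤N → ¬prime[1] (subst Prime (ℕ.∣1⇒≡1 (p∣1 p≤N)) pp)
    where
    pp = All.lookup factorsPrime p∈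
    instance _ = prime⇒nonZero pp
    p∣1 : p ℕ.≤ N → p ℕ.∣ 1
    p∣1 p≤N = ℕ.∣m+n∣m⇒∣n
      (subst (p ℕ.∣_) (trans (sym isFactorisation) (ℕ.+-comm 1 _)) (∈⇒∣product p∈))
      (ℕ.∣n⇒∣m*n k (ℕ.∣-trans (∣n! p≤N) (ℕ.m≤n⇒m!∣n! p≤N)))
      where
      ∣n! : p ℕ.≤ N → p ℕ.∣ p !
      ∣n! _ = subst (λ n → n ℕ.∣ n !) (ℕ.suc-pred p) (ℕ.m∣m*n (ℕ.pred p !))

-- Differences, periods and elimination

infix 20 _⊖_
_⊖_ : Point → Point → Point
(x₁ , y₁) ⊖ (x₂ , y₂) = (x₁ - x₂ , y₁ - y₂)

Per : Point → Fn → Set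
Per t h = ∀ u → h (u ⊕ t) ≡ h u

Bounded : Fn → Set
Bounded h = Σ[ B ∈ ℕ ] ∀ u → ∣ h u ∣ ℕ.≤ B

Δ : Point → Fn → Fn
Δ w h u = h (u ⊕ w) - h u

Δ* : List Point → Fn → Fn
Δ* []       h = h
Δ* (w ∷ ws) h = Δ* ws (Δ w h)

per-⊕ : ∀ {s t h} → Per s h → Per t h → Per (s ⊕ t) h
per-⊕ {s} {t} {h} ps pt u = trans (cong h (sym (⊕-assoc u s t))) (trans (pt (u ⊕ s)) (ps u))

per-ℕ· : ∀ {t h} n → Per t h → Per ((+ n) · t) h
per-ℕ· {t} {h} zero    pt u = cong h (⊕-0· u t)
per-ℕ· {t} {h} (suc n) pt u =
  trans (cong h (sym (⊕-suc· n u t))) (trans (per-ℕ· n pt (u ⊕ t)) (pt u))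

per-· : ∀ {t h} k → Per t h → Per (k · t) h
per-· (+ n) pt = per-ℕ· n pt
per-· {t} {h} -[1+ n ] pt u =
  trans (sym (per-ℕ· (suc n) pt (u ⊕ -[1+ n ] · t))) (cong h (cancel (+ suc n) u t))
  where
  cancel : ∀ k u t → (u ⊕ (- k) · t) ⊕ k · t ≡ u
  cancel k u t = cong₂ _,_ (lem k (proj₁ u) (proj₁ t)) (lem k (proj₂ u) (proj₂ t))
    where
    lem : ∀ k a b → (a + (- k) * b) + k * b ≡ a
    lem = solve-∀

bounded-Δ : ∀ {h} w → Bounded h → Bounded (Δ w h)
bounded-Δ {h} w (B , h≤B) = B ℕ.+ B , λ u →
  ℕ.≤-trans (ℤ.∣i-j∣≤∣i∣+∣j∣ (h (u ⊕ w)) (h u)) (ℕ.+-mono-≤ (h≤B (u ⊕ w)) (h≤B u))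

-- Otherwise h would grow linearly along t.
per-Δ-self : ∀ {h} t → Bounded h → Per t (Δ t h) → Per t h
per-Δ-self {h} t (B , h≤B) pΔ u = ℤ.i-j≡0⇒i≡j _ _ (ℤ.∣i∣≡0⇒i≡0 (small ∣ Δ t h u ∣ bound))
  where
  linear : ∀ k u → h (u ⊕ (+ k) · t) - h u ≡ + k * Δ t h u
  linear zero    u = trans (cong (λ w → h w - h u) (⊕-0· u t)) (trans (ℤ.+-inverseʳ (h u)) (sym (ℤ.*-zeroˡ (Δ t h u))))
  linear (suc k) u = begin
    h (u ⊕ (+ suc k) · t) - h u
      ≡⟨ cong (λ w → h w - h u) (⊕-suc· k u t) ⟨
    h ((u ⊕ t) ⊕ (+ k) · t) - h u
      ≡⟨ lem (h ((u ⊕ t) ⊕ (+ k) · t)) (h (u ⊕ t)) (h u) ⟩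
    (h ((u ⊕ t) ⊕ (+ k) · t) - h (u ⊕ t)) + Δ t h u
      ≡⟨ cong (_+ Δ t h u) (trans (linear k (u ⊕ t)) (cong (+ k *_) (pΔ u))) ⟩
    + k * Δ t h u + Δ t h u
      ≡⟨ trans (ℤ.+-comm _ (Δ t h u)) (sym (ℤ.suc-* (+ k) (Δ t h u))) ⟩
    + suc k * Δ t h u ∎
    where
    lem : ∀ a b c → a - c ≡ (a - b) + (b - c)
    lem = solve-∀
  -- Values of `h` differ by at most 2B, so 2B + 1 steps of a nonzero constant increment are too
  -- many.
  bound : suc (B ℕ.+ B) ℕ.* ∣ Δ t h u ∣ ℕ.≤ B ℕ.+ B
  bound = subst (ℕ._≤ B ℕ.+ B)
    (trans (cong ∣_∣ (linear (suc (B ℕ.+ B)) u)) (ℤ.abs-* (+ suc (B ℕ.+ B)) (Δ t h u)))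
    (ℕ.≤-trans (ℤ.∣i-j∣≤∣i∣+∣j∣ (h (u ⊕ (+ suc (B ℕ.+ B)) · t)) (h u)) (ℕ.+-mono-≤ (h≤B _) (h≤B u)))
  small : ∀ n → suc (B ℕ.+ B) ℕ.* n ℕ.≤ B ℕ.+ B → n ≡ 0
  small zero    le = refl
  small (suc n) le = contradiction (ℕ.≤-trans (ℕ.m≤m*n (suc (B ℕ.+ B)) (suc n)) le) (ℕ.<-irrefl refl)

-- Differences commute, so the hypothesis makes `Δ (k · w) h` invariant under `w`, hence under
-- `k · w`, and `per-Δ-self` applies.
per-Δ : ∀ {h} k w → Bounded h → Per (k · w) (Δ w h) → Per (k · w) h
per-Δ {h} k w bh pΔ = per-Δ-self (k · w) bh (per-· k λ u →
  trans (cong (λ v → h v - h (u ⊕ w)) (⊕-swapʳ u w (k · w)))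
    (trans (lem₁ (h ((u ⊕ k · w) ⊕ w)) (h (u ⊕ k · w)) (h (u ⊕ w)) (h u))
      (trans (cong (λ z → (z - Δ w h u) + (h (u ⊕ k · w) - h u)) (pΔ u))
        (lem₂ (Δ w h u) (h (u ⊕ k · w) - h u)))))
  where
  lem₁ : ∀ a b c d → a - c ≡ ((a - b) - (c - d)) + (b - d)
  lem₁ = solve-∀
  lem₂ : ∀ a b → (a - a) + b ≡ b
  lem₂ = solve-∀

PositiveMultiple : Point → Point → Set
PositiveMultiple e w = Σ[ l ∈ ℕ ] w ≡ (+ suc l) · e

-- Factors are peeled off by `per-Δ`, which wants a period that is a multiple of `w`. A period of
-- `Δ w h` along `e` becomes one after multiplication by the length of `w` in units of `e`.
per-Δ*-line : ∀ e {ws h} → All (PositiveMultiple e) ws → Bounded h → (∀ u → Δ* ws h u ≡ 0ℤ) →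
  Σ[ K ∈ ℕ ] Per ((+ suc K) · e) h
per-Δ*-line e []  bh h≡0 = 0 , λ u → trans (h≡0 _) (sym (h≡0 u))
per-Δ*-line e {w ∷ ws} {h} ((l , refl) ∷ pws) bh Δ≡0 with per-Δ*-line e pws (bounded-Δ {h} w bh) Δ≡0
-- The successor of this witness is `suc K * suc l`.
... | K , pK = l ℕ.+ K ℕ.* suc l ,
  subst (λ t → Per t h) (trans (·-assoc (+ suc K) (+ suc l) e) (cong (_· e) (sym (ℤ.pos-* (suc K) (suc l)))))
    (per-Δ (+ suc K) w bh
      (subst (λ t → Per t (Δ w h)) (trans (·-assoc-comm (+ suc l) (+ suc K) e) (sym (·-assoc (+ suc K) (+ suc l) e)))
        (per-· (+ suc l) pK)))

-- Subtracting the relation for (k + 1, u) from that for (k, u + w a) cancels the term of a.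
eliminate₀ : ∀ {A : Set} (L : List A) (w : A → Point) (g : A → Fn) (g₀ : Fn) →
  (∀ k u → g₀ u + ∑ L (λ a → g a (u ⊕ (+ k) · w a)) ≡ 0ℤ) →
  ∀ u → Δ* (map w L) g₀ u ≡ 0ℤ
eliminate₀ []      w g g₀ rel u = trans (sym (ℤ.+-identityʳ (g₀ u))) (rel 0 u)
eliminate₀ (a ∷ L) w g g₀ rel =
  -- Each surviving term again has a fixed function evaluated at `u ⊕ k · w b`, so the relations
  -- keep their shape for all `k` and the induction can continue.
  eliminate₀ L w (λ b u → g b (u ⊕ w a) - g b (u ⊕ w b)) (Δ (w a) g₀) λ k u → begin
    Δ (w a) g₀ u + ∑ L (λ b → g b ((u ⊕ (+ k) · w b) ⊕ w a) - g b ((u ⊕ (+ k) · w b) ⊕ w b))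
      ≡⟨ cong (_+_ (Δ (w a) g₀ u)) (∑-cong L λ b → cong₂ (λ s t → g b s - g b t)
           (⊕-swapʳ u ((+ k) · w b) (w a)) (trans (⊕-swapʳ u ((+ k) · w b) (w b)) (⊕-suc· k u (w b)))) ⟩
    Δ (w a) g₀ u + ∑ L (λ b → G k (u ⊕ w a) b - G (suc k) u b)
      ≡⟨ cong (_+_ (Δ (w a) g₀ u)) (∑-- L (G k (u ⊕ w a)) (G (suc k) u)) ⟨
    Δ (w a) g₀ u + (∑ L (G k (u ⊕ w a)) - ∑ L (G (suc k) u))
      ≡⟨ lem (g₀ (u ⊕ w a)) (g₀ u) _ _ (G (suc k) u a) ⟩
    (g₀ (u ⊕ w a) + (G (suc k) u a + ∑ L (G k (u ⊕ w a)))) - (g₀ u + ∑ (a ∷ L) (G (suc k) u))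
      ≡⟨ cong (λ s → (g₀ (u ⊕ w a) + (g a s + ∑ L (G k (u ⊕ w a)))) - (g₀ u + ∑ (a ∷ L) (G (suc k) u)))
           (⊕-suc· k u (w a)) ⟨
    (g₀ (u ⊕ w a) + ∑ (a ∷ L) (G k (u ⊕ w a))) - (g₀ u + ∑ (a ∷ L) (G (suc k) u))
      ≡⟨ cong₂ _-_ (rel k (u ⊕ w a)) (rel (suc k) u) ⟩
    0ℤ ∎
  where
  G : ℕ → Point → _ → ℤ
  G k u b = g b (u ⊕ (+ k) · w b)
  lem : ∀ a b c d e → (a - b) + (c - d) ≡ (a + (e + c)) - (b + (e + d))
  lem = solve-∀

-- Evaluating the relation at `u ⊖ k · w₀` holds the first term still and gives the others the
-- relative speeds `w a ⊖ w₀`.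
eliminate : ∀ {A : Set} (L : List A) (w : A → Point) (w₀ : Point) (g : A → Fn) (g₀ : Fn) →
  (∀ k u → g₀ (u ⊕ (+ k) · w₀) + ∑ L (λ a → g a (u ⊕ (+ k) · w a)) ≡ 0ℤ) →
  ∀ u → Δ* (map (λ a → w a ⊖ w₀) L) g₀ u ≡ 0ℤ
eliminate L w w₀ g g₀ rel = eliminate₀ L (λ a → w a ⊖ w₀) g g₀ λ k u →
  trans (sym (cong₂ _+_ (cong g₀ (shift₀ (+ k) u w₀)) (∑-cong L λ a → cong (g a) (shift (+ k) u (w a) w₀))))
    (rel k (u ⊖ (+ k) · w₀))
  where
  shift₀ : ∀ k u v → (u ⊖ k · v) ⊕ k · v ≡ u
  shift₀ k u v = cong₂ _,_ (lem k (proj₁ u) (proj₁ v)) (lem k (proj₂ u) (proj₂ v))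
    where
    lem : ∀ k a b → (a - k * b) + k * b ≡ a
    lem = solve-∀
  shift : ∀ k u v v₀ → (u ⊖ k · v₀) ⊕ k · v ≡ u ⊕ k · (v ⊖ v₀)
  shift k u v v₀ =
    cong₂ _,_ (lem k (proj₁ u) (proj₁ v) (proj₁ v₀)) (lem k (proj₂ u) (proj₂ v) (proj₂ v₀))
    where
    lem : ∀ k a b c → (a - k * c) + k * b ≡ a + k * (b - c)
    lem = solve-∀

O : Point
O = 0ℤ , 0ℤ

-- The right-hand side joins the sum as a term with coefficient `- d` at the origin. It does not
-- depend on `k`, which matches `ω O ≡ O`. Shifting everything by `v₀` turns the singled-out term
-- into `h` itself.
eliminate-translates : ∀ d (v₀ : Point) (vs : List Point) (ω : Point → Point) (h : Fn) → ω O ≡ O →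
  (∀ k u → h ((u ⊕ v₀) ⊕ (+ k) · ω v₀) + ∑ vs (λ v → h ((u ⊕ v) ⊕ (+ k) · ω v)) ≡ d * h u) →
  ∀ u → Δ* (map (λ v → ω v ⊖ ω v₀) (O ∷ vs)) h u ≡ 0ℤ
eliminate-translates d v₀ vs ω h ωO rel u =
  trans (cong (λ ws → Δ* ((ω O ⊖ ω v₀) ∷ ws) h u) (map-∘ vs))
    (eliminate ((- d , O) ∷ map (1ℤ ,_) vs) (ω ∘ proj₂) (ω v₀) (λ a u → proj₁ a * h (u ⊕ (proj₂ a ⊖ v₀))) h rel′ u)
  where
  lem : ∀ a b c → a + ((- b) * c) ≡ a - b * c
  lem = solve-∀
  move : ∀ u v x → ((u ⊖ v₀) ⊕ v) ⊕ x ≡ (u ⊕ x) ⊕ (v ⊖ v₀)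
  move u v x =
    cong₂ _,_ (lem₁ (proj₁ u) (proj₁ v) (proj₁ v₀) (proj₁ x)) (lem₁ (proj₂ u) (proj₂ v) (proj₂ v₀) (proj₂ x))
    where
    lem₁ : ∀ a b c d → ((a - c) + b) + d ≡ (a + d) + (b - c)
    lem₁ = solve-∀
  move₀ : ∀ u x → ((u ⊖ v₀) ⊕ v₀) ⊕ x ≡ u ⊕ x
  move₀ u x = cong (_⊕ x) (cong₂ _,_ (lem₁ (proj₁ u) (proj₁ v₀)) (lem₁ (proj₂ u) (proj₂ v₀)))
    where
    lem₁ : ∀ a c → (a - c) + c ≡ a
    lem₁ = solve-∀
  origin : ∀ k u → (u ⊕ (+ k) · ω O) ⊕ (O ⊖ v₀) ≡ u ⊖ v₀
  origin k u rewrite ωO = cong₂ _,_ (lem₁ (+ k) (proj₁ u) (proj₁ v₀)) (lem₁ (+ k) (proj₂ u) (proj₂ v₀))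
    where
    lem₁ : ∀ k a c → (a + k * 0ℤ) + (0ℤ - c) ≡ a - c
    lem₁ = solve-∀
  term : ℕ → Point → ℤ × Point → ℤ
  term k u a = proj₁ a * h ((u ⊕ (+ k) · ω (proj₂ a)) ⊕ (proj₂ a ⊖ v₀))
  rel′ : ∀ k u → h (u ⊕ (+ k) · ω v₀) + ((- d) * h ((u ⊕ (+ k) · ω O) ⊕ (O ⊖ v₀)) +
    ∑ (map (1ℤ ,_) vs) (term k u)) ≡ 0ℤ
  rel′ k u = begin
    h (u ⊕ (+ k) · ω v₀) + ((- d) * h ((u ⊕ (+ k) · ω O) ⊕ (O ⊖ v₀)) +
      ∑ (map (1ℤ ,_) vs) (term k u))
      ≡⟨ cong₂ _+_ (cong h (sym (move₀ u _))) (cong₂ _+_ (cong (λ s → (- d) * h s) (origin k u))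
           (trans (∑-map (1ℤ ,_) vs (term k u)) (∑-cong vs λ v →
             trans (ℤ.*-identityˡ _) (cong h (sym (move u v ((+ k) · ω v))))))) ⟩
    h (((u ⊖ v₀) ⊕ v₀) ⊕ (+ k) · ω v₀) + ((- d) * h (u ⊖ v₀) + ∑ vs (λ v → h (((u ⊖ v₀) ⊕ v) ⊕ (+ k) · ω v)))
      ≡⟨ lem₂ (h (((u ⊖ v₀) ⊕ v₀) ⊕ (+ k) · ω v₀)) d (h (u ⊖ v₀)) (∑ vs (λ v → h (((u ⊖ v₀) ⊕ v) ⊕ (+ k) · ω v))) ⟩
    (h (((u ⊖ v₀) ⊕ v₀) ⊕ (+ k) · ω v₀) + ∑ vs (λ v → h (((u ⊖ v₀) ⊕ v) ⊕ (+ k) · ω v))) - d * h (u ⊖ v₀)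
      ≡⟨ ℤ.i≡j⇒i-j≡0 (rel k (u ⊖ v₀)) ⟩
    0ℤ ∎
    where
    lem₂ : ∀ a d b c → a + ((- d) * b + c) ≡ (a + c) - d * b
    lem₂ = solve-∀

-- The square neighbourhood

act-king : ∀ r m h u → act (map ((+ m) ·_) (kingNbhd r)) h u ≡
  ∑ (interval r) (λ x → ∑ (interval r) (λ y → h (u ⊕ (+ m) · (x , y))))
act-king r m h u =
  trans (∑-map ((+ m) ·_) (kingNbhd r) (λ v → h (u ⊕ v)))
    (trans (∑-concatMap (λ x → map (x ,_) (interval r)) (interval r) F)
      (∑-cong (interval r) λ x → ∑-map (x ,_) (interval r) F))
  where
  F : Fn
  F v = h (u ⊕ (+ m) · v)

lowest highest : ℕ → ℤ
lowest  r = + 0 - + r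
highest r = + (r ℕ.+ r) - + r

aboveLowest belowHighest : ℕ → List ℤ
aboveLowest  r = map (λ i → + i - + r) (applyUpTo suc (r ℕ.+ r))
belowHighest r = map (λ i → + i - + r) (upTo (r ℕ.+ r))

interval-∷ʳ : ∀ r (F : ℤ → ℤ) → ∑ (interval r) F ≡ F (highest r) + ∑ (belowHighest r) F
interval-∷ʳ r F = begin
  ∑ (interval r) F
    ≡⟨ ∑-map f (upTo (suc (r ℕ.+ r))) F ⟩
  ∑ (upTo (suc (r ℕ.+ r))) (F ∘ f)
    ≡⟨ cong (λ is → ∑ is (F ∘ f)) (upTo-∷ʳ (r ℕ.+ r)) ⟨
  ∑ (upTo (r ℕ.+ r) ++ (r ℕ.+ r) ∷ []) (F ∘ f)
    ≡⟨ ∑-++ (upTo (r ℕ.+ r)) _ (F ∘ f) ⟩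
  ∑ (upTo (r ℕ.+ r)) (F ∘ f) + (F (highest r) + 0ℤ)
    ≡⟨ cong₂ _+_ (sym (∑-map f (upTo (r ℕ.+ r)) F)) (ℤ.+-identityʳ _) ⟩
  ∑ (belowHighest r) F + F (highest r)
    ≡⟨ ℤ.+-comm _ (F (highest r)) ⟩
  F (highest r) + ∑ (belowHighest r) F ∎
  where
  f : ℕ → ℤ
  f i = + i - + r

-- The square without the corner `(lowest r , y₀)` when `L` is the interval without `y₀`: the rest
-- of the corner's column, then the other columns.
cornerRest : ℕ → List ℤ → List Point
cornerRest r L = map (lowest r ,_) L ++ concatMap (λ x → map (x ,_) (interval r)) (aboveLowest r)

∑-corner : ∀ r y₀ L → (∀ F → ∑ (interval r) F ≡ F y₀ + ∑ L F) → ∀ F →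
  ∑ (interval r) (λ x → ∑ (interval r) (λ y → F (x , y))) ≡ F (lowest r , y₀) + ∑ (cornerRest r L) F
∑-corner r y₀ L split F = begin
  -- By computation `interval r` is `lowest r ∷ aboveLowest r`.
  ∑ I (λ y → F (lowest r , y)) + ∑ A (λ x → ∑ I (λ y → F (x , y)))
    ≡⟨ cong₂ _+_ (split (λ y → F (lowest r , y)))
         (sym (trans (∑-concatMap (λ x → map (x ,_) I) A F) (∑-cong A λ x → ∑-map (x ,_) I F))) ⟩
  (F (lowest r , y₀) + ∑ L (λ y → F (lowest r , y))) + ∑ (concatMap (λ x → map (x ,_) I) A) F
    ≡⟨ ℤ.+-assoc (F (lowest r , y₀)) _ _ ⟩
  F (lowest r , y₀) + (∑ L (λ y → F (lowest r , y)) + ∑ (concatMap (λ x → map (x ,_) I) A) F)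
    ≡⟨ cong (_+_ (F (lowest r , y₀)))
         (sym (trans (∑-++ (map (lowest r ,_) L) _ F)
           (cong (_+ ∑ (concatMap (λ x → map (x ,_) I) A) F) (∑-map (lowest r ,_) L F)))) ⟩
  F (lowest r , y₀) + ∑ (cornerRest r L) F ∎
  where
  I = interval r
  A = aboveLowest r

Natural Positive : ℤ → Set
Natural  z = Σ[ n ∈ ℕ ] z ≡ + n
Positive z = Σ[ n ∈ ℕ ] NonZero n × z ≡ + n

-- `a` and `b` are the distances of the point from the two sides of the square that meet in the
-- chosen corner. `δ` measures the second one, from the bottom or from the top, and the last
-- condition excludes the corner itself.
Offset : ℕ → (ℤ → ℤ) → Point → Set
Offset r δ (x , y) = Σ[ a ∈ ℕ ] Σ[ b ∈ ℕ ] x + + r ≡ + a × δ y ≡ + b × NonZero (a ℕ.+ b)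

nonZero-+ˡ : ∀ m n → NonZero m → NonZero (m ℕ.+ n)
nonZero-+ˡ (suc m) n nz = _

i-r+r : ∀ i r → (i - r) + r ≡ i
i-r+r = solve-∀

r-[i-r] : ∀ {i} r → i ℕ.≤ r ℕ.+ r → + r - (+ i - + r) ≡ + (r ℕ.+ r ℕ.∸ i)
r-[i-r] {i} r i≤2r = trans (lem (+ r) (+ i)) (trans (ℤ.m-n≡m⊖n (r ℕ.+ r) i) (ℤ.⊖-≥ i≤2r))
  where
  lem : ∀ r i → r - (i - r) ≡ (r + r) - i
  lem = solve-∀

interval-lower : ∀ r → All (λ x → Natural (x + + r)) (interval r)
interval-lower r = All.map⁺ (All.universal (λ i → i , i-r+r (+ i) (+ r)) (upTo (suc (r ℕ.+ r))))

interval-upper : ∀ r → All (λ x → Natural (+ r - x)) (interval r)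
interval-upper r = All.map⁺ (All.map (λ i≤ → _ , r-[i-r] r (ℕ.≤-pred i≤)) (All.all-upTo (suc (r ℕ.+ r))))

aboveLowest-positive : ∀ r → All (λ x → Positive (x + + r)) (aboveLowest r)
aboveLowest-positive r =
  All.map⁺ (All.applyUpTo⁺₂ suc (r ℕ.+ r) λ i → suc i , _ , i-r+r (+ suc i) (+ r))

belowHighest-positive : ∀ r → All (λ x → Positive (+ r - x)) (belowHighest r)
belowHighest-positive r = All.map⁺
  (All.map (λ i< → _ , ℕ.>-nonZero (ℕ.m<n⇒0<n∸m i<) , r-[i-r] r (ℕ.<⇒≤ i<)) (All.all-upTo (r ℕ.+ r)))

cornerRest-offset : ∀ r (δ : ℤ → ℤ) {L} → All (λ y → Positive (δ y)) L →
  All (λ y → Natural (δ y)) (interval r) → All (Offset r δ) (cornerRest r L)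
cornerRest-offset r δ pos nat = All.++⁺
  (All.map⁺ (All.map (λ { (n , nz , eq) → 0 , n , i-r+r 0ℤ (+ r) , eq , nz }) pos))
  (All.concat⁺ (All.map⁺ (All.map
    (λ { (m , nz , eq) → All.map⁺ (All.map (λ { (n , eq′) → m , n , eq , eq′ , nonZero-+ˡ m n nz }) nat) })
    (aboveLowest-positive r))))

positiveMultiple : ∀ {w} e n → NonZero n → w ≡ (+ n) · e → PositiveMultiple e w
positiveMultiple e (suc n) nz eq = n , eq

-- Periods along the axes

e₁ e₂ : Point
e₁ = + 1 , + 0
e₂ = + 0 , + 1

n·e₁ : ∀ n → n · e₁ ≡ (n , + 0)
n·e₁ n = cong₂ _,_ (ℤ.*-identityʳ n) (ℤ.*-zeroʳ n)

n·e₂ : ∀ n → n · e₂ ≡ (+ 0 , n)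
n·e₂ n = cong₂ _,_ (ℤ.*-zeroʳ n) (ℤ.*-identityʳ n)

-- With one common `K` for both axes, `(+ suc K) · w` is a period for every vector `w`.
BiPeriodic : ℕ → Fn → Set
BiPeriodic K h = Per ((+ suc K) · e₁) h × Per ((+ suc K) · e₂) h

-- Nonzero vectors with nonnegative coordinates fall into three kinds, treated separately in
-- `biperiodic`: horizontal, vertical, and with both coordinates positive.
Quadrant : Point → Set
Quadrant w = Σ[ p ∈ ℕ ] Σ[ q ∈ ℕ ] w ≡ (+ p , + q) × NonZero (p ℕ.+ q)

per-≡ : ∀ {s t h} → s ≡ t → Per s h → Per t h
per-≡ {h = h} = subst (λ t → Per t h)

biperiodic-horizontal : ∀ {h} p → Per (+ suc p , + 0) h → Σ[ K ∈ ℕ ] Per ((+ suc K) · e₂) h →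
  Σ[ K ∈ ℕ ] BiPeriodic K h
biperiodic-horizontal p pw (K , pK) =
  p ℕ.+ K ℕ.* suc p ,
  per-≡ (trans (cong ((+ suc K) ·_) (sym (n·e₁ (+ suc p)))) (·-assoc (+ suc K) (+ suc p) e₁)) (per-· (+ suc K) pw) ,
  per-≡ (·-assoc-comm (+ suc p) (+ suc K) e₂) (per-· (+ suc p) pK)

biperiodic-swap : ∀ {h} → Σ[ K ∈ ℕ ] BiPeriodic K (h ∘ swap) → Σ[ K ∈ ℕ ] BiPeriodic K h
biperiodic-swap (K , p₁ , p₂) = K , p₂ ∘ swap , p₁ ∘ swap

-- Multiply the diagonal period by `suc K`; its horizontal part is then a multiple of the known
-- horizontal period, and subtracting it leaves a vertical period.
biperiodic-diagonal : ∀ {h} p q → Per (+ suc p , + suc q) h → Σ[ K ∈ ℕ ] Per ((+ suc K) · e₁) h →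
  Σ[ K ∈ ℕ ] BiPeriodic K h
biperiodic-diagonal p q pw (K , pK) =
  q ℕ.+ K ℕ.* suc q ,
  per-≡ (·-assoc-comm (+ suc q) (+ suc K) e₁) (per-· (+ suc q) pK) ,
  per-≡ (trans (lem (+ suc K) (+ suc p) (+ suc q)) (·-assoc (+ suc K) (+ suc q) e₂))
    (per-⊕ (per-· (+ suc K) pw) (per-· (- + suc p) pK))
  where
  lem : ∀ k p q → (k · (p , q)) ⊕ (- p) · k · e₁ ≡ k · q · e₂
  lem k p q = cong₂ _,_ (lem₁ k p q) (lem₂ k p q)
    where
    lem₁ : ∀ k p q → k * p + (- p) * (k * 1ℤ) ≡ k * (q * 0ℤ)
    lem₁ = solve-∀
    lem₂ : ∀ k p q → k * q + (- p) * (k * 0ℤ) ≡ k * (q * 1ℤ)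
    lem₂ = solve-∀

quadrant-scale : ∀ K {w} → Quadrant w → Quadrant ((+ suc K) · w)
quadrant-scale K (p , q , refl , nz) =
  suc K ℕ.* p , suc K ℕ.* q , cong₂ _,_ (sym (ℤ.pos-* (suc K) p)) (sym (ℤ.pos-* (suc K) q)) ,
  subst NonZero (ℕ.*-distribˡ-+ (suc K) p q) (ℕ.m*n≢0 (suc K) (p ℕ.+ q) {{_}} {{nz}})

biperiodic⇒per : ∀ {h} K w → BiPeriodic K h → Per ((+ suc K) · w) h
biperiodic⇒per K (x , y) (p₁ , p₂) = per-≡ (lem (+ suc K) x y) (per-⊕ (per-· x p₁) (per-· y p₂))
  where
  lem : ∀ k p q → (p · k · e₁) ⊕ (q · k · e₂) ≡ k · (p , q)
  lem k p q = cong₂ _,_ (lem₁ k p q) (lem₂ k p q)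
    where
    lem₁ : ∀ k p q → p * (k * 1ℤ) + q * (k * 0ℤ) ≡ k * p
    lem₁ = solve-∀
    lem₂ : ∀ k p q → p * (k * 0ℤ) + q * (k * 1ℤ) ≡ k * q
    lem₂ = solve-∀

-- Peeling off differences under the dilated relations

module _ (r : ℕ) .{{_ : NonZero r}} (d : ℤ) (d≢0 : d ≢ 0ℤ) (M-1 : ℕ) where

  M : ℕ
  M = suc M-1

  -- Taking differences may enlarge the bound, but by linearity it preserves the relations with the
  -- same `M`. The class is therefore closed under `Δ`.
  record Good (h : Fn) : Set where
    field
      bounded : Bounded h
      dilated : ∀ k → Eigen d (map ((+ suc (k ℕ.* M)) ·_) (kingNbhd r)) h
  open Good

  square-sum : ∀ {h} → Good h → ∀ k u →
    ∑ (interval r) (λ x → ∑ (interval r) (λ y → h (u ⊕ (+ suc (k ℕ.* M)) · (x , y)))) ≡ d * h u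
  square-sum {h} gh k u = trans (sym (act-king r (suc (k ℕ.* M)) h u)) (at (dilated gh k) u)

  good-Δ : ∀ {h} w → Good h → Good (Δ w h)
  good-Δ {h} w gh = record
    { bounded = bounded-Δ {h} w (bounded gh)
    ; dilated = λ k → eigen λ u → let L = map ((+ suc (k ℕ.* M)) ·_) (kingNbhd r) in begin
        ∑ L (λ v → h ((u ⊕ v) ⊕ w) - h (u ⊕ v))
          ≡⟨ ∑-cong L (λ v → cong (λ s → h s - h (u ⊕ v)) (⊕-swapʳ u v w)) ⟩
        ∑ L (λ v → h ((u ⊕ w) ⊕ v) - h (u ⊕ v))
          ≡⟨ ∑-- L (λ v → h ((u ⊕ w) ⊕ v)) (λ v → h (u ⊕ v)) ⟨
        act L h (u ⊕ w) - act L h u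
          ≡⟨ cong₂ _-_ (at (dilated gh k) (u ⊕ w)) (at (dilated gh k) u) ⟩
        d * h (u ⊕ w) - d * h u
          ≡⟨ lem d (h (u ⊕ w)) (h u) ⟩
        d * Δ w h u ∎
    }
    where
    lem : ∀ d a b → d * a - d * b ≡ d * (a - b)
    lem = solve-∀

  good-swap : ∀ {h} → Good h → Good (h ∘ swap)
  good-swap {h} gh = record
    { bounded = proj₁ (bounded gh) , λ u → proj₂ (bounded gh) (swap u)
    ; dilated = λ k → eigen λ u →
        trans (act-king r (suc (k ℕ.* M)) (h ∘ swap) u)
          (trans (∑-swap (interval r) (interval r) (λ x y → h (swap (u ⊕ (+ suc (k ℕ.* M)) · (x , y)))))
            (square-sum gh k (swap u)))
    }

  scale : ∀ k q → + suc (k ℕ.* q ℕ.* M) ≡ 1ℤ + + k * + q * + M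
  scale k q = cong (_+_ 1ℤ) (trans (ℤ.pos-* (k ℕ.* q) M) (cong (_* + M) (ℤ.pos-* k q)))

  -- Only the dilations by 1 + k q M are used. By the last hypothesis the term of `v` then moves
  -- with constant speed `ω v` as `k` grows, so every term but that of the corner can be eliminated.
  corner-kills : ∀ {h} → Good h → ∀ y₀ L → (∀ F → ∑ (interval r) F ≡ F y₀ + ∑ L F) →
    ∀ (ω : Point → Point) q → ω O ≡ O →
    (∀ k u v → h (u ⊕ (+ suc (k ℕ.* q ℕ.* M)) · v) ≡ h ((u ⊕ v) ⊕ (+ k) · ω v)) →
    ∀ u → Δ* (map (λ v → ω v ⊖ ω (lowest r , y₀)) (O ∷ cornerRest r L)) h u ≡ 0ℤ
  corner-kills {h} gh y₀ L split ω q ωO move =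
    eliminate-translates d (lowest r , y₀) (cornerRest r L) ω h ωO λ k u →
      trans (sym (∑-corner r y₀ L split (λ v → h ((u ⊕ v) ⊕ (+ k) · ω v))))
        (trans (∑-cong (interval r) λ x → ∑-cong (interval r) λ y → sym (move k u (x , y)))
          (square-sum gh (k ℕ.* q) u))

  offsets : ∀ δ → δ 0ℤ ≡ + r → ∀ {L} → All (λ y → Positive (δ y)) L →
    All (λ y → Natural (δ y)) (interval r) → All (Offset r δ) (O ∷ cornerRest r L)
  offsets δ eq pos nat =
    -- The origin stands for the term `d * h u`. It lies at distance r from both sides, and r is
    -- positive.
    (r , r , refl , eq , nonZero-+ˡ r r (ℕ.>-nonZero (ℕ.>-nonZero⁻¹ r))) ∷ cornerRest-offset r δ pos nat

  -- The speed of `v` is `M · v`. Relative to the corner (-r , -r) all other speeds lie in the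
  -- quadrant.
  quadrant-kills : ∀ {h} → Good h → Σ[ ws ∈ List Point ] All Quadrant ws × (∀ u → Δ* ws h u ≡ 0ℤ)
  quadrant-kills {h} gh =
    map (λ v → ω v ⊖ ω (lowest r , lowest r)) (O ∷ rest) ,
    All.map⁺ (All.map (λ {v} → quadrant v) (offsets (_+ + r) refl (aboveLowest-positive r) (interval-lower r))) ,
    corner-kills gh (lowest r) (aboveLowest r) (λ F → refl) ω 1
      (cong₂ _,_ (ℤ.*-zeroʳ (+ M)) (ℤ.*-zeroʳ (+ M)))
      (λ k u v → cong h (trans (cong (λ n → u ⊕ n · v) (scale k 1)) (move (+ k) u v)))
    where
    rest = cornerRest r (aboveLowest r)
    ω : Point → Point
    ω v = (+ M) · v
    move : ∀ k u v → u ⊕ (1ℤ + k * 1ℤ * + M) · v ≡ (u ⊕ v) ⊕ k · ω v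
    move k u v = cong₂ _,_ (lem k (+ M) (proj₁ u) (proj₁ v)) (lem k (+ M) (proj₂ u) (proj₂ v))
      where
      lem : ∀ k m a b → a + (1ℤ + k * 1ℤ * m) * b ≡ (a + b) + k * (m * b)
      lem = solve-∀
    quadrant : ∀ v → Offset r (_+ + r) v → Quadrant (ω v ⊖ ω (lowest r , lowest r))
    quadrant (x , y) (a , b , eqa , eqb , nz) =
      M ℕ.* a , M ℕ.* b ,
      cong₂ _,_ (trans (lem (+ M) x (+ r)) (trans (cong (+ M *_) eqa) (sym (ℤ.pos-* M a))))
                (trans (lem (+ M) y (+ r)) (trans (cong (+ M *_) eqb) (sym (ℤ.pos-* M b)))) ,
      subst NonZero (ℕ.*-distribˡ-+ M a b) (ℕ.m*n≢0 M (a ℕ.+ b) {{_}} {{nz}})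
      where
      lem : ∀ m x r → m * x - m * (0ℤ - r) ≡ m * (x + r)
      lem = solve-∀

  -- Modulo w the vector q (i , j) is a horizontal one of length q i − p j, a linear form whose
  -- minimum over the square is attained only at the corner (−r , r).
  per-diagonal : ∀ {h} → Good h → ∀ p q → Per (+ suc p , + suc q) h →
    Σ[ K ∈ ℕ ] Per ((+ suc K) · e₁) h
  per-diagonal {h} gh p q pw =
    per-Δ*-line e₁
      (All.map⁺ (All.map (λ {v} → positive v)
        (offsets (λ y → + r - y) (ℤ.+-identityʳ (+ r)) (belowHighest-positive r) (interval-upper r))))
      (bounded gh)
      (corner-kills gh (highest r) (belowHighest r) (interval-∷ʳ r) ω (suc q)
        (cong (_, + 0) (ω0 (+ M) (+ suc p) (+ suc q))) move)
    where
    ω : Point → Point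
    ω (x , y) = + M * (+ suc q * x - + suc p * y) , + 0
    ω0 : ∀ m p q → m * (q * 0ℤ - p * 0ℤ) ≡ 0ℤ
    ω0 = solve-∀
    move : ∀ k u v → h (u ⊕ (+ suc (k ℕ.* suc q ℕ.* M)) · v) ≡ h ((u ⊕ v) ⊕ (+ k) · ω v)
    move k u (x , y) = trans
      (cong h (trans (cong (λ n → u ⊕ n · (x , y)) (scale k (suc q)))
        (cong₂ _,_ (lem₁ (+ k) (+ suc p) (+ suc q) (+ M) (proj₁ u) x y) (lem₂ (+ k) (+ suc q) (+ M) (proj₂ u) y))))
      -- The factor q in the dilation makes the extra vertical displacement k q M y exactly k M y
      -- times the height of the period. Removing that many periods leaves a horizontal motion.
      (per-· (+ k * + M * y) pw ((u ⊕ (x , y)) ⊕ (+ k) · ω (x , y)))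
      where
      lem₁ : ∀ k p q m a x y →
        a + (1ℤ + k * q * m) * x ≡ ((a + x) + k * (m * (q * x - p * y))) + (k * m * y) * p
      lem₁ = solve-∀
      lem₂ : ∀ k q m b y → b + (1ℤ + k * q * m) * y ≡ ((b + y) + k * 0ℤ) + (k * m * y) * q
      lem₂ = solve-∀
    positive : ∀ v → Offset r (λ y → + r - y) v → PositiveMultiple e₁ (ω v ⊖ ω (lowest r , highest r))
    positive (x , y) (a , b , eqa , eqb , nz) =
      positiveMultiple e₁ N (ℕ.m*n≢0 M (suc q ℕ.* a ℕ.+ suc p ℕ.* b) {{_}} {{nz′}})
        (trans (cong (_, + 0) eq) (sym (n·e₁ (+ N))))
      where
      N = M ℕ.* (suc q ℕ.* a ℕ.+ suc p ℕ.* b)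
      nz′ : NonZero (suc q ℕ.* a ℕ.+ suc p ℕ.* b)
      nz′ = subst NonZero (lem p q a b) (nonZero-+ˡ (a ℕ.+ b) (q ℕ.* a ℕ.+ p ℕ.* b) nz)
        where
        lem : ∀ p q a b → (a ℕ.+ b) ℕ.+ (q ℕ.* a ℕ.+ p ℕ.* b) ≡ suc q ℕ.* a ℕ.+ suc p ℕ.* b
        lem = ℕ.solve-∀
      lem : ∀ m p q r x y →
        m * (q * x - p * y) - m * (q * (0ℤ - r) - p * ((r + r) - r)) ≡ m * (q * (x + r) + p * (r - y))
      lem = solve-∀
      eq : + M * (+ suc q * x - + suc p * y) - + M * (+ suc q * lowest r - + suc p * highest r) ≡ + N
      eq = begin
        + M * (+ suc q * x - + suc p * y) - + M * (+ suc q * lowest r - + suc p * highest r)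
          ≡⟨ lem (+ M) (+ suc p) (+ suc q) (+ r) x y ⟩
        + M * (+ suc q * (x + + r) + + suc p * (+ r - y))
          ≡⟨ cong₂ (λ s t → + M * (+ suc q * s + + suc p * t)) eqa eqb ⟩
        + M * (+ suc q * + a + + suc p * + b)
          ≡⟨ cong₂ (λ s t → + M * (s + t)) (ℤ.pos-* (suc q) a) (ℤ.pos-* (suc p) b) ⟨
        + M * + (suc q ℕ.* a ℕ.+ suc p ℕ.* b)
          ≡⟨ ℤ.pos-* M _ ⟨
        + N ∎

  -- Here whole rows can be eliminated: the row sum at height −r is killed by vertical differences, so
  -- all row sums are vertically periodic, and d h is a sum of row sums.
  row : Fn → ℤ → Fn
  row h j u = ∑ (interval r) (λ x → h (u ⊕ (x , j)))

  -- Modulo a horizontal period all points of one row have the same speed, so no single corner can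
  -- be isolated. Under dilation by 1 + k p M, with p here the length of the period, row `j` moves
  -- as a whole with vertical speed M p j, and the lowest row has the strictly smallest speed.
  per-lowest-row : ∀ {h} → Good h → ∀ p → Per (+ suc p , + 0) h →
    Σ[ K ∈ ℕ ] Per ((+ suc K) · e₂) (row h (lowest r))
  per-lowest-row {h} gh p pw =
    per-Δ*-line e₂ (All.map⁺ positives) row-bounded
      (eliminate terms proj₂ (ω (lowest r)) proj₁ (row h (lowest r)) relation)
    where
    ω : ℤ → Point
    ω j = + 0 , + M * + suc p * j
    terms : List (Fn × Point)
    -- The first entry carries the stationary right-hand side, as if it were a row at height 0.
    terms = ((λ u → (- d) * h u) , O) ∷ map (λ j → row h j , ω j) (aboveLowest r)
    row-bounded : Bounded (row h (lowest r))
    row-bounded = _ , λ u → ∑-bound (interval r) (λ x → h (u ⊕ (x , lowest r))) _ (λ x → proj₂ (bounded gh) (u ⊕ (x , lowest r)))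
    positive : ∀ j → Positive (j + + r) → PositiveMultiple e₂ (ω j ⊖ ω (lowest r))
    positive j (n , nz , eq) =
      positiveMultiple e₂ (M ℕ.* suc p ℕ.* n) (ℕ.m*n≢0 (M ℕ.* suc p) n {{_}} {{nz}})
        (trans (cong (+ 0 ,_) (trans (lem (+ M * + suc p) j (+ r))
          (trans (cong (+ M * + suc p *_) eq) (sym (ℤ.pos-* (M ℕ.* suc p) n)))))
          (sym (n·e₂ (+ (M ℕ.* suc p ℕ.* n)))))
      where
      lem : ∀ m x r → m * x - m * (0ℤ - r) ≡ m * (x + r)
      lem = solve-∀
    positive-origin : PositiveMultiple e₂ (O ⊖ ω (lowest r))
    positive-origin = subst (λ z → PositiveMultiple e₂ (+ 0 , z - + M * + suc p * lowest r)) (ℤ.*-zeroʳ (+ M * + suc p))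
      (positive 0ℤ (r , ℕ.>-nonZero (ℕ.>-nonZero⁻¹ r) , refl))
    positives : All (λ a → PositiveMultiple e₂ (proj₂ a ⊖ ω (lowest r))) terms
    positives = positive-origin ∷ All.map⁺ (All.map (λ {j} → positive j) (aboveLowest-positive r))
    relation : ∀ k u → row h (lowest r) (u ⊕ (+ k) · ω (lowest r)) +
      ∑ terms (λ a → proj₁ a (u ⊕ (+ k) · proj₂ a)) ≡ 0ℤ
    relation k u = begin
      row h (lowest r) (u ⊕ (+ k) · ω (lowest r)) +
        ((- d) * h (u ⊕ (+ k) · O) + ∑ (map (λ j → row h j , ω j) (aboveLowest r)) (λ a → proj₁ a (u ⊕ (+ k) · proj₂ a)))
        ≡⟨ cong₂ (λ s t → row h (lowest r) (u ⊕ (+ k) · ω (lowest r)) + ((- d) * h s + t))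
             (cong₂ _,_ (lem₀ (+ k) (proj₁ u)) (lem₀ (+ k) (proj₂ u)))
             (∑-map (λ j → row h j , ω j) (aboveLowest r) (λ a → proj₁ a (u ⊕ (+ k) · proj₂ a))) ⟩
      row h (lowest r) (u ⊕ (+ k) · ω (lowest r)) +
        ((- d) * h u + ∑ (aboveLowest r) (λ j → row h j (u ⊕ (+ k) · ω j)))
        ≡⟨ lem (row h (lowest r) (u ⊕ (+ k) · ω (lowest r))) d (h u) (∑ (aboveLowest r) (λ j → row h j (u ⊕ (+ k) · ω j))) ⟩
      ∑ (interval r) (λ j → row h j (u ⊕ (+ k) · ω j)) - d * h u
        ≡⟨ ℤ.i≡j⇒i-j≡0 (trans (∑-cong (interval r) λ j → ∑-cong (interval r) λ x → move x j)
             (trans (sym (∑-swap (interval r) (interval r) (λ x j → h (u ⊕ (+ suc (k ℕ.* suc p ℕ.* M)) · (x , j)))))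
               (square-sum gh (k ℕ.* suc p) u))) ⟩
      0ℤ ∎
      where
      lem₀ : ∀ k a → a + k * 0ℤ ≡ a
      lem₀ = solve-∀
      lem : ∀ a d b c → a + ((- d) * b + c) ≡ (a + c) - d * b
      lem = solve-∀
      move : ∀ x j → h ((u ⊕ (+ k) · ω j) ⊕ (x , j)) ≡ h (u ⊕ (+ suc (k ℕ.* suc p ℕ.* M)) · (x , j))
      move x j = sym (trans
        (cong h (trans (cong (λ n → u ⊕ n · (x , j)) (scale k (suc p)))
          (cong₂ _,_ (lem₁ (+ k) (+ suc p) (+ M) (proj₁ u) x) (lem₂ (+ k) (+ suc p) (+ M) (proj₂ u) x j))))
        (per-· (+ k * + M * x) pw ((u ⊕ (+ k) · ω j) ⊕ (x , j))))
        where
        lem₁ : ∀ k p m a x → a + (1ℤ + k * p * m) * x ≡ ((a + k * 0ℤ) + x) + (k * m * x) * p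
        lem₁ = solve-∀
        lem₂ : ∀ k p m b x y → b + (1ℤ + k * p * m) * y ≡ ((b + k * (m * p * y)) + y) + (k * m * x) * 0ℤ
        lem₂ = solve-∀

  row-sum : ∀ {h} → Good h → ∀ u → ∑ (interval r) (λ j → row h j u) ≡ d * h u
  row-sum {h} gh u = trans (sym (∑-swap (interval r) (interval r) (λ x j → h (u ⊕ (x , j)))))
    (trans (∑-cong (interval r) λ x → ∑-cong (interval r) λ y → cong (λ v → h (u ⊕ v)) (sym (·-identity (x , y))))
      (square-sum gh 0 u))

  row-raise : ∀ h j u → row h j u ≡ row h (lowest r) (u ⊕ (+ 0 , j - lowest r))
  row-raise h j u = ∑-cong (interval r) λ x →
    cong h (cong₂ _,_ (lem₁ (proj₁ u) x) (lem₂ (proj₂ u) j (lowest r)))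
    where
    lem₁ : ∀ a x → a + x ≡ (a + 0ℤ) + x
    lem₁ = solve-∀
    lem₂ : ∀ b j l → b + j ≡ (b + (j - l)) + l
    lem₂ = solve-∀

  per-row : ∀ {h} t → Per t (row h (lowest r)) → ∀ j → Per t (row h j)
  per-row {h} t pt j u = trans (row-raise h j (u ⊕ t))
    (trans (cong (row h (lowest r)) (⊕-swapʳ u t up)) (trans (pt (u ⊕ up)) (sym (row-raise h j u))))
    where
    up : Point
    up = + 0 , j - lowest r

  per-from-row : ∀ {h} → Good h → ∀ t → Per t (row h (lowest r)) → Per t h
  -- Every row sum is a vertical translate of the lowest one and so inherits its period. Cancelling
  -- `d`, which is nonzero because a and b differ, passes the period to `h`.
  per-from-row {h} gh t pt u = ℤ.*-cancelˡ-≡ d (h (u ⊕ t)) (h u) {{≢-nonZero d≢0}} (begin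
    d * h (u ⊕ t)
      ≡⟨ row-sum gh (u ⊕ t) ⟨
    ∑ (interval r) (λ j → row h j (u ⊕ t))
      ≡⟨ ∑-cong (interval r) (λ j → per-row {h} t pt j u) ⟩
    ∑ (interval r) (λ j → row h j u)
      ≡⟨ row-sum gh u ⟩
    d * h u ∎)

  per-horizontal : ∀ {h} → Good h → ∀ p → Per (+ suc p , + 0) h → Σ[ K ∈ ℕ ] Per ((+ suc K) · e₂) h
  per-horizontal gh p pw = map₂ (λ {K} → per-from-row gh ((+ suc K) · e₂)) (per-lowest-row gh p pw)

  -- A single period suffices for a good function. The vertical case is the horizontal one reflected
  -- in the diagonal, a symmetry of the square.
  biperiodic : ∀ {h w} → Good h → Quadrant w → Per w h → Σ[ K ∈ ℕ ] BiPeriodic K h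
  biperiodic gh (zero  , zero  , _ , nz) pw = contradiction refl (ℕ.≢-nonZero⁻¹ 0 {{nz}})
  biperiodic gh (suc p , zero  , refl , _) pw = biperiodic-horizontal p pw (per-horizontal gh p pw)
  biperiodic gh (zero  , suc q , refl , _) pw =
    biperiodic-swap (biperiodic-horizontal q (pw ∘ swap) (per-horizontal (good-swap gh) q (pw ∘ swap)))
  biperiodic gh (suc p , suc q , refl , _) pw = biperiodic-diagonal p q pw (per-diagonal gh p q pw)

  -- The induction hypothesis applies to `Δ w h`, which is good again. Its common period gives `h` a
  -- period along `w`, still in the quadrant, and `biperiodic` supplies the second direction.
  biperiodic-Δ* : ∀ {ws h} → Good h → All Quadrant ws → (∀ u → Δ* ws h u ≡ 0ℤ) → Σ[ K ∈ ℕ ] BiPeriodic K h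
  biperiodic-Δ* gh [] h≡0 = 0 , (λ u → trans (h≡0 _) (sym (h≡0 u))) , (λ u → trans (h≡0 _) (sym (h≡0 u)))
  biperiodic-Δ* {w ∷ ws} {h} gh (quad ∷ quads) Δ≡0 = step (biperiodic-Δ* (good-Δ w gh) quads Δ≡0)
    where
    step : Σ[ K ∈ ℕ ] BiPeriodic K (Δ w h) → Σ[ K ∈ ℕ ] BiPeriodic K h
    step (K , bp) = biperiodic gh (quadrant-scale K quad) (per-Δ (+ suc K) w (bounded gh) (biperiodic⇒per K w bp))

  good⇒biperiodic : ∀ {h} → Good h → Σ[ K ∈ ℕ ] BiPeriodic K h
  good⇒biperiodic gh = step (quadrant-kills gh)
    where
    step : Σ[ ws ∈ List Point ] All Quadrant ws × (∀ u → Δ* ws _ u ≡ 0ℤ) → _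
    step (ws , quads , Δ≡0) = biperiodic-Δ* gh quads Δ≡0

-- From coverings to eigenfunctions and back

+-sum : ∀ {A : Set} (f : A → ℕ) xs → + sum (map f xs) ≡ ∑ xs (λ x → + f x)
+-sum f []       = refl
+-sum f (x ∷ xs) = cong (_+_ (+ f x)) (+-sum f xs)

bit-injective : ∀ {x y} → bit x ≡ bit y → x ≡ y
bit-injective {false} {false} eq = refl
bit-injective {true}  {true}  eq = refl

indicator : Config → Fn
indicator c u = + bit (c u)

bounded-indicator : ∀ c → Bounded (indicator c)
bounded-indicator c = 1 , λ u → bit≤1 (c u)
  where
  bit≤1 : ∀ x → bit x ℕ.≤ 1
  bit≤1 false = z≤n
  bit≤1 true  = s≤s z≤n

per-indicator : ∀ {c t} → Per t (indicator c) → IsPeriodic c t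
per-indicator pt u = bit-injective (ℤ.+-injective (pt u))

-- The covering condition is affine in the indicator, with value a + (b - a) χ. Taking a difference
-- removes the constant a and leaves an eigenvalue relation.
covering⇒eigen : ∀ {D b a c} → IsCovering D b a c → ∀ t → Eigen (+ b - + a) D (Δ t (indicator c))
covering⇒eigen {D} {b} {a} {c} cov t = eigen λ u → begin
  ∑ D (λ v → χ ((u ⊕ v) ⊕ t) - χ (u ⊕ v))
    ≡⟨ ∑-cong D (λ v → cong (λ s → χ s - χ (u ⊕ v)) (⊕-swapʳ u v t)) ⟩
  ∑ D (λ v → χ ((u ⊕ t) ⊕ v) - χ (u ⊕ v))
    ≡⟨ ∑-- D (λ v → χ ((u ⊕ t) ⊕ v)) (λ v → χ (u ⊕ v)) ⟨
  act D χ (u ⊕ t) - act D χ u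
    ≡⟨ cong₂ _-_ (count (u ⊕ t)) (count u) ⟩
  (+ a + (+ b - + a) * χ (u ⊕ t)) - (+ a + (+ b - + a) * χ u)
    ≡⟨ lem (+ a) (+ b - + a) (χ (u ⊕ t)) (χ u) ⟩
  (+ b - + a) * Δ t χ u ∎
  where
  χ = indicator c
  lem : ∀ a d x y → (a + d * x) - (a + d * y) ≡ d * (x - y)
  lem = solve-∀
  affine : ∀ x → + (if x then b else a) ≡ + a + (+ b - + a) * + bit x
  affine false = lem₀ (+ a) (+ b)
    where
    lem₀ : ∀ a b → a ≡ a + (b - a) * 0ℤ
    lem₀ = solve-∀
  affine true  = lem₁ (+ a) (+ b)
    where
    lem₁ : ∀ a b → b ≡ a + (b - a) * 1ℤ
    lem₁ = solve-∀
  count : ∀ u → act D χ u ≡ + a + (+ b - + a) * χ u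
  count u = trans (sym (+-sum (λ v → bit (c (u ⊕ v))) D)) (trans (cong +_ (cov u)) (affine (c u)))

covering-Δ-biperiodic : ∀ r .{{_ : NonZero r}} {a b c} → a ≢ b → IsCovering (kingNbhd r) b a c →
  ∀ t → Σ[ K ∈ ℕ ] BiPeriodic K (Δ t (indicator c))
-- The step M of the progression is `N !`, passed through its predecessor because M is a successor
-- by construction.
covering-Δ-biperiodic r {a} {b} {c} a≢b cov t = good⇒biperiodic r d d≢0 (ℕ.pred (N !)) record
  { bounded = bounded-h
  ; dilated = λ k → subst (λ m → Eigen d (map ((+ suc (k ℕ.* m)) ·_) (kingNbhd r)) (Δ t (indicator c)))
      (sym (ℕ.suc-pred (N !) {{N ℕ.!≢0}}))
      (eigen-progression (proj₁ bounded-h) (proj₂ bounded-h) (covering⇒eigen {kingNbhd r} {b} {a} {c} cov t) k)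
  }
  where
  d = + b - + a
  d≢0 : d ≢ 0ℤ
  d≢0 eq = a≢b (sym (ℤ.+-injective (ℤ.i-j≡0⇒i≡j (+ b) (+ a) eq)))
  bounded-h = bounded-Δ {indicator c} t (bounded-indicator c)
  N = (length (kingNbhd r) ℕ.+ ∣ d ∣) ℕ.* proj₁ bounded-h

linIndep-axes : ∀ K L → LinIndep ((+ suc K) · e₁) ((+ suc L) · e₂)
linIndep-axes K L eq = contradiction (trans (sym (lem (+ suc K) (+ suc L))) eq) λ ()
  where
  lem : ∀ k l → (k * 1ℤ) * (l * 1ℤ) - (k * 0ℤ) * (l * 0ℤ) ≡ k * l
  lem = solve-∀

-- `per-Δ` lifts a period only along the direction of the difference, so the horizontal period comes
-- from `Δ e₁` and the vertical one from `Δ e₂`.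
twoPeriodic : ∀ {c} → Σ[ K ∈ ℕ ] BiPeriodic K (Δ e₁ (indicator c)) →
  Σ[ K ∈ ℕ ] BiPeriodic K (Δ e₂ (indicator c)) → TwoPeriodic c
twoPeriodic {c} (K , pK , _) (L , _ , pL) =
  (+ suc K) · e₁ , (+ suc L) · e₂ , linIndep-axes K L ,
  per-indicator {c} (per-Δ (+ suc K) e₁ (bounded-indicator c) pK) ,
  per-indicator {c} (per-Δ (+ suc L) e₂ (bounded-indicator c) pL)

theorem12 : (r : ℕ) → r ≥ 1 → (a b : ℕ) → a ≢ b →
    (c : Config) → IsCovering (kingNbhd r) b a c → TwoPeriodic c
theorem12 r r≥1 a b a≢b c cov = twoPeriodic (biperiodic-Δ e₁) (biperiodic-Δ e₂)
  where
  biperiodic-Δ = covering-Δ-biperiodic r {{ℕ.>-nonZero r≥1}} {c = c} a≢b cov
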